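{- Let $k$ be a positive integer and let $\zeta$ be a primitive $2k$-th root of unity. For a positive integer $m$, let $Q_m$ denote the set of quasipolarities of $\mathbb{Z}/2m\mathbb{Z}$. Then \[ \sum_{\pi\in Q_{k}}\prod_{j=0}^{2k-1}\frac{1+\zeta^{j-\pi(j)}}{1-\zeta^{j-\pi(j)}} = [2\mid k]\,\bigl(|Q_{2k}|-|Q_{k}|\bigr) = [2\mid k]\,\bigl(s_{1}^{*}(2k)-s_{1}^{*}(k)\bigr). \]
   Context: For a positive integer $m$, the affine general linear group $\overrightarrow{GL}(\mathbb{Z}/2m\mathbb{Z})$ consists of the maps $e^{u}.v:\mathbb{Z}/2m\mathbb{Z}\to\mathbb{Z}/2m\mathbb{Z}$, $x\mapsto vx+u$, with $u\in\mathbb{Z}/2m\mathbb{Z}$ and $v\in(\mathbb{Z}/2m\mathbb{Z})^{\times}$. A quasipolarity of $\mathbb{Z}/2m\mathbb{Z}$ is an element $\pi$ of this group that is an involution ($\pi\circ\pi=\mathrm{id}$) and a derangement ($\pi(j)\neq j$ for all $j$). Elements of $\mathbb{Z}/2k\mathbb{Z}$ are identified with $0,1,\dots,2k-1$, and $\zeta^{j-\pi(j)}$ is well defined since $\zeta^{2k}=1$. $[2\mid k]$ is the Iverson bracket: $1$ if $k$ is even and $0$ otherwise. A divisor $d$ of $n$ is unitary if $\gcd(d,n/d)=1$, and $s_1^{*}(n)$ is the sum of the unitary divisors of $n$. -}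

module Defs where

open import Level using (Level; _⊔_) renaming (suc to lsuc)
open import Data.Nat using (ℕ; zero; suc; _<_; _≤_)
open import Data.Nat.DivMod using (_%_; _/_)
open import Data.Nat.Divisibility using (_∣_; _∣?_)
open import Data.Nat.Coprimality using (Coprime; coprime?)
open import Data.Fin using (Fin; toℕ)
import Data.Fin.Properties as FinP
open import Data.List using (List; []; _∷_; upTo; filter; length; map; foldr; cartesianProduct)
open import Data.Product using (_×_; _,_; proj₁; proj₂)
open import Relation.Nullary using (¬_; Dec)
open import Relation.Nullary.Decidable using (_×-dec_; ¬?)
open import Relation.Binary.PropositionalEquality using (_≡_; _≢_)
open import Algebra.Bundles using (CommutativeRing)
import Data.Nat as ℕ

-- Arithmetic in ℤ/2mℤ, elements represented by 0,…,2m-1.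
-- Everything is defined for m ≥ 1 (m = suc m'); for m = 0 the set Q_0
-- is taken to be empty (never used: the theorem assumes k ≥ 1).

aff : (m' : ℕ) → ℕ → ℕ → ℕ → ℕ
aff m' u v x = (v ℕ.* x ℕ.+ u) % (2 ℕ.* suc m')

IsQuasipolarity : (m' : ℕ) → ℕ × ℕ → Set
IsQuasipolarity m' (u , v) =
  Coprime v (2 ℕ.* suc m') ×
  ((x : Fin (2 ℕ.* suc m')) → aff m' u v (aff m' u v (toℕ x)) ≡ toℕ x) ×
  ((x : Fin (2 ℕ.* suc m')) → aff m' u v (toℕ x) ≢ toℕ x)

isQuasipolarity? : (m' : ℕ) → (p : ℕ × ℕ) → Dec (IsQuasipolarity m' p)
isQuasipolarity? m' (u , v) =
  coprime? v (2 ℕ.* suc m') ×-dec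
  (FinP.all? (λ x → aff m' u v (aff m' u v (toℕ x)) ℕ.≟ toℕ x) ×-dec
   FinP.all? (λ x → ¬? (aff m' u v (toℕ x) ℕ.≟ toℕ x)))

-- Q_m : the quasipolarities of ℤ/2mℤ, listed as parameter pairs (u , v)
-- with 0 ≤ u, v < 2m.  Distinct pairs give distinct maps
-- (u = π(0), v = π(1) - π(0)), so this list enumerates Q_m without repetition.
Q : ℕ → List (ℕ × ℕ)
Q zero = []
Q (suc m') = filter (isQuasipolarity? m')
  (cartesianProduct (upTo (2 ℕ.* suc m')) (upTo (2 ℕ.* suc m')))

apply : ℕ → ℕ × ℕ → ℕ → ℕ
apply zero _ x = x
apply (suc m') (u , v) x = aff m' u v x

-- d ∣ n and gcd(d, n/d) = 1 (d ≥ 1 written as suc i)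
IsUnitaryDivisor : ℕ → ℕ → Set
IsUnitaryDivisor n i = (suc i ∣ n) × Coprime (suc i) (n / suc i)

isUnitaryDivisor? : (n i : ℕ) → Dec (IsUnitaryDivisor n i)
isUnitaryDivisor? n i = (suc i ∣? n) ×-dec coprime? (suc i) (n / suc i)

s1* : ℕ → ℕ
s1* n = foldr ℕ._+_ 0 (map suc (filter (isUnitaryDivisor? n) (upTo n)))

-- Fields of characteristic 0 (classical style: a total inverse function
-- that is a two-sided inverse on nonzero elements).

module RingOps {c ℓ : Level} (R : CommutativeRing c ℓ) where
  open CommutativeRing R

  ofℕ : ℕ → Carrier
  ofℕ zero = 0#
  ofℕ (suc n) = 1# + ofℕ n

  _^_ : Carrier → ℕ → Carrier
  x ^ zero = 1#
  x ^ suc n = x * (x ^ n)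

record CharZeroField (c ℓ : Level) : Set (lsuc (c ⊔ ℓ)) where
  field
    commutativeRing : CommutativeRing c ℓ
  open CommutativeRing commutativeRing public
  open RingOps commutativeRing public
  field
    _⁻¹        : Carrier → Carrier
    0≉1        : ¬ (0# ≈ 1#)
    ⁻¹-inverse : ∀ x → ¬ (x ≈ 0#) → x * (x ⁻¹) ≈ 1#
    charZero   : ∀ n → ¬ (ofℕ (suc n) ≈ 0#)

  _÷_ : Carrier → Carrier → Carrier
  x ÷ y = x * (y ⁻¹)

  IsPrimitiveRoot : ℕ → Carrier → Set ℓ
  IsPrimitiveRoot n ζ = (ζ ^ n ≈ 1#) × (∀ j → 0 < j → j < n → ¬ (ζ ^ j ≈ 1#))

  -- Σ_{π ∈ Q_k} ∏_{j=0}^{2k-1} (1 + ζ^{j-π(j)}) / (1 - ζ^{j-π(j)})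
  -- where ζ^{j-π(j)} is computed as ζ^{j + (2k - π(j))}  (0 ≤ π(j) < 2k),
  -- which is legitimate since ζ^{2k} = 1
  quasiSum : ℕ → Carrier → Carrier
  quasiSum k ζ =
    foldr _+_ 0# (map (λ π →
      foldr _*_ 1# (map (λ j →
        let e = j ℕ.+ (2 ℕ.* k ℕ.∸ apply k π j) in
        (1# + ζ ^ e) ÷ (1# - ζ ^ e)) (upTo (2 ℕ.* k)))) (Q k))

iverson2∣ : ℕ → ℕ
iverson2∣ k with 2 ∣? k
... | Relation.Nullary.yes _ = 1
... | Relation.Nullary.no _ = 0

{-# OPTIONS --safe #-}
-- A quasipolarity x ↦ v x + u of ℤ/2k has the normal form k = h g, v = 1 + 2 c g, u = (1 + 2 s) g with
-- h ∣ 1 + c g and c , s < h. Here h = gcd ((v + 1) / 2, k) is a unitary divisor of k, it determines c, and s is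
-- free; hence |Q_k| = Σ h = s₁*(k). The exponent j - π(j) is minus 2 c g j + u modulo 2k. If h is odd it takes the
-- value k for some j, so a numerator 1 + ζ^k vanishes; if h is even, translating j by g h / 2 adds k to it, so the
-- numerators are a permutation of the denominators. The sum is therefore Σ h over the even unitary divisors h of k.
-- When k is even the unitary divisors of 2k are those of k with the even ones doubled, so this is s₁*(2k) - s₁*(k).
module Submission where

open import Defs

-- Elementary congruences and the normal form of a quasipolarity.

module Arithmetic where

  open import Data.Nat
  open import Data.Nat.Properties
  open import Data.Nat.DivMod
  open import Data.Nat.Divisibility
  open import Data.Nat.GCD using (gcd; gcd-GCD; gcd[m,n]∣m; gcd[m,n]∣n; gcd-greatest; gcd[m,n]≢0; module Bézout)
  open import Data.Nat.Coprimality using (Coprime; coprime-divisor)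
  open import Data.Nat.Tactic.RingSolver using (solve-∀)
  open import Data.Fin using (fromℕ<)
  open import Data.Fin.Properties using (toℕ-fromℕ<; toℕ<n)
  open import Data.Product using (_,_; ∃)
  open import Data.Sum using (_⊎_; inj₁; inj₂)
  open import Relation.Nullary using (¬_; contradiction)
  open import Relation.Binary.PropositionalEquality

  m≡r+qn⇒m%n≡r%n : ∀ {m} r q n .{{_ : NonZero n}} → m ≡ r + q * n → m % n ≡ r % n
  m≡r+qn⇒m%n≡r%n r q n refl = [m+kn]%n≡m%n r q n

  even⊎odd : ∀ n → (∃ λ q → n ≡ 2 * q) ⊎ (∃ λ q → n ≡ suc (2 * q))
  even⊎odd zero = inj₁ (0 , refl)
  even⊎odd (suc n) with even⊎odd n
  ... | inj₁ (q , refl) = inj₂ (q , refl)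
  ... | inj₂ (q , refl) = inj₁ (suc q , cong suc (sym (+-suc q (q + 0))))

  suc[2m]<2n : ∀ {m n} → m < n → suc (2 * m) < 2 * n
  suc[2m]<2n {m} {n} m<n = begin-strict
    suc (2 * m)  <⟨ n<1+n _ ⟩
    2 + 2 * m    ≡⟨ *-suc 2 m ⟨
    2 * suc m    ≤⟨ *-monoʳ-≤ 2 m<n ⟩
    2 * n        ∎
    where open ≤-Reasoning

  suc[2m]<2n⇒m<n : ∀ {m n} → suc (2 * m) < 2 * n → m < n
  suc[2m]<2n⇒m<n lt = *-cancelˡ-< 2 _ _ (<-trans (n<1+n _) lt)

  -- Bézout's identity solved as `a x ≡ - gcd a n`, which stays within the natural numbers. When
  -- Bézout gives `d + y n = x a`, the factor `p = n - 1 ≡ -1` reverses the sign.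
  linear-congruence : ∀ a n .{{_ : NonZero n}} → ∃ λ x → n ∣ a * x + gcd a n
  linear-congruence a n@(suc p) with gcd a n | Bézout.identity (gcd-GCD a n)
  ... | d | Bézout.+- x y eq = x * p , divides (d + y * p) (begin
    a * (x * p) + d        ≡⟨ cong (_+ d) (lem a x p) ⟩
    (x * a) * p + d        ≡⟨ cong (λ z → z * p + d) eq ⟨
    (d + y * n) * p + d    ≡⟨ lem′ d y p ⟩
    (d + y * p) * n        ∎)
    where
    open ≡-Reasoning
    lem : ∀ a x p → a * (x * p) ≡ (x * a) * p
    lem = solve-∀
    lem′ : ∀ d y p → (d + y * suc p) * p + d ≡ (d + y * p) * suc p
    lem′ = solve-∀
  ... | d | Bézout.-+ x y eq = x , divides y (trans (trans (+-comm (a * x) d) (cong (d +_) (*-comm a x))) eq)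

  -- The field `a` witnesses `h ∣ 1 + c g`, the condition behind `v² ≡ 1` and `(v + 1) u ≡ 0` modulo
  -- `2 k`. The bounds on `s` and `c` amount to `u < 2 k` and `v < 2 k`.
  record Normal (k u v h : ℕ) : Set where
    constructor normal
    field
      g a c s : ℕ
      k≡  : k ≡ h * g
      ah≡ : a * h ≡ suc (c * g)
      u≡  : u ≡ suc (2 * s) * g
      v≡  : v ≡ suc (2 * (c * g))
      s<h : s < h
      c<h : c < h

  [v*[x%n]+u]%n≡[v*x+u]%n : ∀ v u x n .{{_ : NonZero n}} → (v * (x % n) + u) % n ≡ (v * x + u) % n
  [v*[x%n]+u]%n≡[v*x+u]%n v u x n = sym (m≡r+qn⇒m%n≡r%n (v * (x % n) + u) (v * (x / n)) n (begin
    v * x + u                       ≡⟨ cong (λ z → v * z + u) (m≡m%n+[m/n]*n x n) ⟩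
    v * (x % n + x / n * n) + u     ≡⟨ lem v (x % n) u (x / n) n ⟩
    v * (x % n) + u + v * (x / n) * n ∎))
    where
    open ≡-Reasoning
    lem : ∀ v r u q n → v * (r + q * n) + u ≡ v * r + u + v * q * n
    lem = solve-∀

  aff-% : ∀ m u v x → aff m u v (x % (2 * suc m)) ≡ aff m u v x
  aff-% m u v x = [v*[x%n]+u]%n≡[v*x+u]%n v u x (2 * suc m)

  -- With g = gcd w k, h = k / g and u = t g, the absence of fixed points makes t odd; hence h ∣ 2 (1 + w) and
  -- h ∣ t (1 + w) give h ∣ 1 + w, which excludes the square roots of 1 that are ≢ ±1 modulo the 2-part of 2 k.
  congruences⇒normal : ∀ {k u w} .{{_ : NonZero k}} → u < 2 * k → suc (2 * w) < 2 * k →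
                       k ∣ 2 * (w * suc w) → k ∣ suc w * u → (∀ x → ¬ (2 * k ∣ 2 * w * x + u)) →
                       ∃ (Normal k u (suc (2 * w)))
  congruences⇒normal {k} {u} {w} u<2k v<2k k∣2w[1+w] k∣[1+w]u no-root = go (gcd[m,n]∣m w k) (gcd[m,n]∣n w k)
    where
    g = gcd w k

    instance
      g≢0 : NonZero g
      g≢0 = ≢-nonZero (gcd[m,n]≢0 w k (inj₂ (≢-nonZero⁻¹ k)))

    coprime-g-1+w : Coprime g (suc w)
    coprime-g-1+w {d} (d∣g , d∣1+w) =
      ∣1⇒≡1 (∣m+n∣m⇒∣n (subst (d ∣_) (+-comm 1 w) d∣1+w) (∣-trans d∣g (gcd[m,n]∣m w k)))

    g∣u : g ∣ u
    g∣u = coprime-divisor coprime-g-1+w (∣-trans (gcd[m,n]∣n w k) k∣[1+w]u)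

    -- Choose `x` with `w x ≡ - g` modulo `k`. If `u = 2 y g`, then `2 w (x y) + u = 2 y (w x + g)`
    -- vanishes modulo `2 k`, so `x y` is a forbidden root.
    2g∤u : ∀ y → u ≢ 2 * y * g
    2g∤u y u≡ with linear-congruence w k
    ... | x , divides q eq = no-root (x * y) (divides (y * q) (begin
      2 * w * (x * y) + u             ≡⟨ cong (2 * w * (x * y) +_) u≡ ⟩
      2 * w * (x * y) + 2 * y * g     ≡⟨ lem w x y g ⟩
      2 * y * (w * x + g)             ≡⟨ cong (2 * y *_) eq ⟩
      2 * y * (q * k)                 ≡⟨ lem′ y q k ⟩
      y * q * (2 * k)                 ∎))
      where
      open ≡-Reasoning
      lem : ∀ w x y g → 2 * w * (x * y) + 2 * y * g ≡ 2 * y * (w * x + g)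
      lem = solve-∀
      lem′ : ∀ y q k → 2 * y * (q * k) ≡ y * q * (2 * k)
      lem′ = solve-∀

    module _ {c h} (w≡ : w ≡ c * g) (k≡ : k ≡ h * g) where

      coprime-h-c : Coprime h c
      coprime-h-c {d} (d∣h , d∣c) = ∣1⇒≡1 (*-cancelʳ-∣ g (subst (d * g ∣_) (sym (+-identityʳ g))
        (gcd-greatest (subst (d * g ∣_) (sym w≡) (*-monoˡ-∣ g d∣c)) (subst (d * g ∣_) (sym k≡) (*-monoˡ-∣ g d∣h)))))

      h∣2[1+w] : h ∣ 2 * suc w
      h∣2[1+w] = coprime-divisor coprime-h-c (*-cancelʳ-∣ g (subst₂ _∣_ k≡ (begin
        2 * (w * suc w)         ≡⟨ cong (λ z → 2 * (z * suc w)) w≡ ⟩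
        2 * (c * g * suc w)     ≡⟨ lem c g (suc w) ⟩
        c * (2 * suc w) * g     ∎) k∣2w[1+w]))
        where
        open ≡-Reasoning
        lem : ∀ c g x → 2 * (c * g * x) ≡ c * (2 * x) * g
        lem = solve-∀

      h∣1+w : ∀ {s} → u ≡ suc (2 * s) * g → h ∣ suc w
      h∣1+w {s} u≡ = ∣m+n∣m⇒∣n
        (*-cancelʳ-∣ g (subst₂ _∣_ k≡ (trans (cong (suc w *_) u≡) (lem (suc w) s g)) k∣[1+w]u))
        (∣n⇒∣m*n s h∣2[1+w])
        where
        lem : ∀ x s g → x * (suc (2 * s) * g) ≡ (s * (2 * x) + x) * g
        lem = solve-∀

    go : g ∣ w → g ∣ k → ∃ (Normal k u (suc (2 * w)))
    go (divides c w≡) (divides h k≡) with g∣u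
    ... | divides t u≡ with even⊎odd t
    ... | inj₁ (y , refl) = contradiction u≡ (2g∤u y)
    ... | inj₂ (s , refl) with h∣1+w {c} w≡ k≡ {s} u≡
    ... | divides a 1+w≡ = h , record
      { g = g ; a = a ; c = c ; s = s
      ; k≡ = k≡
      ; ah≡ = trans (sym 1+w≡) (cong suc w≡)
      ; u≡ = u≡
      ; v≡ = cong (λ z → suc (2 * z)) w≡
      ; s<h = suc[2m]<2n⇒m<n (*-cancelʳ-< g _ _ (subst₂ _<_ u≡ (trans (cong (2 *_) k≡) (sym (*-assoc 2 h g))) u<2k))
      ; c<h = *-cancelʳ-< g _ _ (subst₂ _<_ w≡ k≡ (suc[2m]<2n⇒m<n {w} v<2k))
      }

  -- The square of the map is evaluated at 0 and 1 only: the value at 0 gives `(v + 1) u ≡ 0`, and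
  -- removing this from the value at 1 gives `v² ≡ 1`. With `v = 1 + 2 w`, halving both congruences
  -- yields the hypotheses of `congruences⇒normal`.
  quasipolarity⇒normal : ∀ {m u v} → u < 2 * suc m → v < 2 * suc m → IsQuasipolarity m (u , v) → ∃ (Normal (suc m) u v)
  quasipolarity⇒normal {m} {u} {v} u<n v<n (coprime , involutive , derangement) with even⊎odd v
  ... | inj₁ (q , refl) = contradiction (coprime {2} (m∣m*n q , m∣m*n (suc m))) λ ()
  ... | inj₂ (w , refl) = congruences⇒normal {w = w} u<n v<n (*-cancelˡ-∣ 2 n∣4w[1+w]) k∣[1+w]u no-root
    where
    n = 2 * suc m

    aff² : ∀ x → x < n → (v * (v * x + u) + u) % n ≡ x
    aff² x x<n = trans (sym (aff-% m u v (v * x + u)))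
      (subst (λ y → aff m u v (aff m u v y) ≡ y) (toℕ-fromℕ< x<n) (involutive (fromℕ< x<n)))

    n∣vu+u : n ∣ v * u + u
    n∣vu+u = subst (λ z → n ∣ v * (z + u) + u) (*-zeroʳ v) (m%n≡0⇒n∣m _ n (aff² 0 z<s))

    n∣4w[1+w] : n ∣ 2 * (2 * (w * suc w))
    n∣4w[1+w] = ∣m+n∣m⇒∣n (divides (X / n) (suc-injective (begin
      suc (v * u + u + 2 * (2 * (w * suc w)))  ≡⟨ lem w u ⟩
      X                          ≡⟨ m≡m%n+[m/n]*n X n ⟩
      X % n + X / n * n          ≡⟨ cong (_+ X / n * n) (aff² 1 (*-monoʳ-≤ 2 (s≤s z≤n))) ⟩
      suc (X / n * n)            ∎))) n∣vu+u
      where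
      open ≡-Reasoning
      X = v * (v * 1 + u) + u
      lem : ∀ w u → suc (suc (2 * w) * u + u + 2 * (2 * (w * suc w))) ≡ suc (2 * w) * (suc (2 * w) * 1 + u) + u
      lem = solve-∀

    k∣[1+w]u : suc m ∣ suc w * u
    k∣[1+w]u = *-cancelˡ-∣ 2 (subst (n ∣_) (lem w u) n∣vu+u)
      where
      lem : ∀ w u → suc (2 * w) * u + u ≡ 2 * (suc w * u)
      lem = solve-∀

    no-root : ∀ x → ¬ (n ∣ 2 * w * x + u)
    no-root x n∣ = derangement (fromℕ< x%n<n) (subst (λ z → aff m u v z ≡ z) (sym (toℕ-fromℕ< x%n<n)) (begin
      aff m u v (x % n)             ≡⟨ aff-% m u v x ⟩
      (x + 2 * w * x + u) % n       ≡⟨ cong (_% n) (+-assoc x (2 * w * x) u) ⟩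
      (x + (2 * w * x + u)) % n     ≡⟨ %-remove-+ʳ x n∣ ⟩
      x % n                         ∎))
      where
      open ≡-Reasoning
      x%n<n = m%n<n x n

  -- Every normal form is a quasipolarity.

  module _ {m u v h} (N : Normal (suc m) u v h) where
    open Normal N

    private
      k = suc m
      n = 2 * k

    instance
      normal⇒g≢0 : NonZero g
      normal⇒g≢0 = ≢-nonZero λ g≡0 → 1+n≢0 (trans k≡ (trans (cong (h *_) g≡0) (*-zeroʳ h)))

    n≡ : n ≡ 2 * h * g
    n≡ = trans (cong (2 *_) k≡) (sym (*-assoc 2 h g))

    normal⇒u<n : u < n
    normal⇒u<n = subst₂ _<_ (sym u≡) (sym n≡) (*-monoˡ-< g (suc[2m]<2n s<h))

    normal⇒v<n : v < n
    normal⇒v<n = subst (_< n) (sym v≡) (suc[2m]<2n (subst (c * g <_) (sym k≡) (*-monoˡ-< g c<h)))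

    -- After division by `g` the right side is the odd number `2 (c x + s) + 1`, whereas a multiple
    -- of `n` leaves an even one. This excludes fixed points, and later it keeps the denominators of
    -- the products away from zero.
    n∤2cgx+u : ∀ x → ¬ (n ∣ 2 * (c * g) * x + u)
    n∤2cgx+u x (divides q eq) = even≢odd (q * h) (c * x + s) (*-cancelʳ-≡ _ _ g (begin
      2 * (q * h) * g                   ≡⟨ lem q h g ⟩
      q * (2 * (h * g))                 ≡⟨ cong (λ z → q * (2 * z)) k≡ ⟨
      q * n                             ≡⟨ eq ⟨
      2 * (c * g) * x + u               ≡⟨ cong (2 * (c * g) * x +_) u≡ ⟩
      2 * (c * g) * x + suc (2 * s) * g ≡⟨ lem′ c g x s ⟩
      suc (2 * (c * x + s)) * g         ∎))
      where
      open ≡-Reasoning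
      lem : ∀ q h g → 2 * (q * h) * g ≡ q * (2 * (h * g))
      lem = solve-∀
      lem′ : ∀ c g x s → 2 * (c * g) * x + suc (2 * s) * g ≡ suc (2 * (c * x + s)) * g
      lem′ = solve-∀

    vx+u≡ : ∀ x → v * x + u ≡ x + (2 * (c * g) * x + u)
    vx+u≡ x = trans (cong (λ z → z * x + u) v≡) (+-assoc x (2 * (c * g) * x) u)

    private
      -- The factor `1 + c g` equals `a h`, and this `h` completes `g` to `k`. The same mechanism
      -- gives `vu+u≡`.
      v²≡ : v * v ≡ 2 * c * a * n + 1
      v²≡ = begin
        v * v                                 ≡⟨ cong₂ _*_ v≡ v≡ ⟩
        suc (2 * (c * g)) * suc (2 * (c * g)) ≡⟨ lem (c * g) ⟩
        4 * (c * g) * suc (c * g) + 1         ≡⟨ cong (λ z → 4 * (c * g) * z + 1) ah≡ ⟨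
        4 * (c * g) * (a * h) + 1             ≡⟨ lem′ c g a h ⟩
        2 * c * a * (2 * (h * g)) + 1         ≡⟨ cong (λ z → 2 * c * a * (2 * z) + 1) k≡ ⟨
        2 * c * a * n + 1                     ∎
        where
        open ≡-Reasoning
        lem : ∀ y → suc (2 * y) * suc (2 * y) ≡ 4 * y * suc y + 1
        lem = solve-∀
        lem′ : ∀ c g a h → 4 * (c * g) * (a * h) + 1 ≡ 2 * c * a * (2 * (h * g)) + 1
        lem′ = solve-∀

      vu+u≡ : v * u + u ≡ a * suc (2 * s) * n
      vu+u≡ = begin
        v * u + u                            ≡⟨ cong₂ (λ v u → v * u + u) v≡ u≡ ⟩
        suc (2 * (c * g)) * (suc (2 * s) * g) + suc (2 * s) * g ≡⟨ lem (c * g) (suc (2 * s) * g) ⟩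
        2 * suc (c * g) * (suc (2 * s) * g)  ≡⟨ cong (λ z → 2 * z * (suc (2 * s) * g)) ah≡ ⟨
        2 * (a * h) * (suc (2 * s) * g)      ≡⟨ lem′ a h (suc (2 * s)) g ⟩
        a * suc (2 * s) * (2 * (h * g))      ≡⟨ cong (λ z → a * suc (2 * s) * (2 * z)) k≡ ⟨
        a * suc (2 * s) * n                  ∎
        where
        open ≡-Reasoning
        lem : ∀ y u → suc (2 * y) * u + u ≡ 2 * suc y * u
        lem = solve-∀
        lem′ : ∀ a h t g → 2 * (a * h) * (t * g) ≡ a * t * (2 * (h * g))
        lem′ = solve-∀

    normal⇒quasipolarity : IsQuasipolarity m (u , v)
    normal⇒quasipolarity = coprime , (λ x → involutive _ (toℕ<n x)) , λ x → derangement _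
      where
      open ≡-Reasoning
      -- `v` is its own inverse modulo `n`, hence a unit.
      coprime : Coprime v n
      coprime {d} (d∣v , d∣n) =
        ∣1⇒≡1 (∣m+n∣m⇒∣n (subst (d ∣_) v²≡ (∣m⇒∣m*n v d∣v)) (∣n⇒∣m*n (2 * c * a) d∣n))

      involutive : ∀ x → x < n → aff m u v (aff m u v x) ≡ x
      involutive x x<n = begin
        aff m u v (aff m u v x)    ≡⟨ aff-% m u v (v * x + u) ⟩
        aff m u v (v * x + u)      ≡⟨ m≡r+qn⇒m%n≡r%n x (2 * c * a * x + a * suc (2 * s)) n (begin
          v * (v * x + u) + u                             ≡⟨ lem v x u ⟩
          v * v * x + (v * u + u)                         ≡⟨ cong₂ (λ y z → y * x + z) v²≡ vu+u≡ ⟩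
          (2 * c * a * n + 1) * x + a * suc (2 * s) * n   ≡⟨ lem′ (2 * c * a) (a * suc (2 * s)) n x ⟩
          x + (2 * c * a * x + a * suc (2 * s)) * n ∎) ⟩
        x % n                      ≡⟨ m<n⇒m%n≡m x<n ⟩
        x                          ∎
        where
        lem : ∀ v x u → v * (v * x + u) + u ≡ v * v * x + (v * u + u)
        lem = solve-∀
        lem′ : ∀ p q n x → (p * n + 1) * x + q * n ≡ x + (p * x + q) * n
        lem′ = solve-∀

      derangement : ∀ x → aff m u v x ≢ x
      derangement x fixed = n∤2cgx+u x (divides ((v * x + u) / n) (+-cancelˡ-≡ x _ _ (begin
        x + (2 * (c * g) * x + u)  ≡⟨ vx+u≡ x ⟨
        v * x + u                  ≡⟨ m≡m%n+[m/n]*n (v * x + u) n ⟩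
        aff m u v x + (v * x + u) / n * n ≡⟨ cong (_+ (v * x + u) / n * n) fixed ⟩
        x + (v * x + u) / n * n    ∎)))

-- Counting quasipolarities by their unitary divisor `h`.

module Counting where

  open Arithmetic
  open import Level using (Level)
  open import Data.Nat
  open import Data.Nat.Properties
  open import Data.Nat.DivMod
  open import Data.Nat.Divisibility
  open import Data.Nat.GCD using (gcd; gcd[m,n]∣m; gcd[m,n]∣n; gcd-greatest)
  open import Data.Nat.Coprimality using (Coprime; coprime-divisor)
  import Data.Nat.Coprimality as Coprime
  open import Data.Nat.ListAction using (sum)
  open import Data.Nat.ListAction.Properties using (sum-++; sum-↭)
  open import Data.Nat.Tactic.RingSolver using (solve-∀)
  open import Data.List using (List; []; _∷_; _++_; map; filter; length; upTo; concatMap; cartesianProduct)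
  open import Data.List.Properties using (map-∘; length-upTo; map-cong; map-id; map-++)
  open import Data.List.Membership.Propositional using (_∈_; find; lose)
  open import Data.List.Membership.Propositional.Properties
  open import Data.List.Membership.Propositional.Properties.WithK using (unique∧set⇒bag)
  open import Data.List.Relation.Binary.BagAndSetEquality using (∼bag⇒↭)
  open import Data.List.Relation.Binary.Permutation.Propositional using (_↭_)
  open import Data.List.Relation.Binary.Permutation.Propositional.Properties using (map⁺)
  open import Data.List.Relation.Unary.All as All using ([]; _∷_)
  open import Data.List.Relation.Unary.Any using (here; there)
  open import Data.List.Relation.Unary.AllPairs using ([]; _∷_)
  open import Data.List.Relation.Unary.Unique.Propositional using (Unique)
  import Data.List.Relation.Unary.Unique.Propositional.Properties as Unique
  open import Data.Product using (_×_; _,_; ∃; proj₁; proj₂)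
  open import Data.Sum using (_⊎_; inj₁; inj₂)
  open import Function using (_∘_; id)
  open import Function.Bundles using (mk⇔)
  open import Relation.Nullary using (¬_; yes; no; contradiction)
  open import Relation.Nullary.Decidable using (toSum)
  open import Relation.Binary.PropositionalEquality

  private variable
    ℓ₁ ℓ₂ : Level
    X : Set ℓ₁
    Y : Set ℓ₂

  -- Lists without repetition and sums over them.

  unique∧set⇒↭ : {xs ys : List X} → Unique xs → Unique ys →
                 (∀ {z} → z ∈ xs → z ∈ ys) → (∀ {z} → z ∈ ys → z ∈ xs) → xs ↭ ys
  unique∧set⇒↭ xs! ys! to from = ∼bag⇒↭ (unique∧set⇒bag xs! ys! (mk⇔ to from))

  map-unique : (f : X → Y) {xs : List X} → (∀ {x y} → x ∈ xs → y ∈ xs → f x ≡ f y → x ≡ y) →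
               Unique xs → Unique (map f xs)
  map-unique f inj []         = []
  map-unique f {x ∷ xs} inj (x∉ ∷ xs!) =
    All.tabulate (λ fy∈ fx≡ → case∈ (∈-map⁻ f fy∈) fx≡) ∷ map-unique f (λ p q → inj (there p) (there q)) xs!
    where
    case∈ : ∀ {z} → ∃ (λ y → y ∈ xs × z ≡ f y) → f x ≢ z
    case∈ (y , y∈ , refl) fx≡ = All.lookup x∉ y∈ (inj (here refl) (there y∈) fx≡)

  -- `tag` recovers from an element the index of its block, so blocks with different indices are
  -- disjoint.
  concatMap-unique : (f : X → List Y) (tag : Y → X) (xs : List X) →
                     (∀ {x} → x ∈ xs → Unique (f x)) → (∀ {x y} → y ∈ f x → tag y ≡ x) →
                     Unique xs → Unique (concatMap f xs)
  concatMap-unique f tag []       f! tag≡ []          = []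
  concatMap-unique f tag (x ∷ xs) f! tag≡ (x∉ ∷ xs!) =
    Unique.++⁺ (f! (here refl)) (concatMap-unique f tag xs (f! ∘ there) tag≡ xs!) disjoint
    where
    disjoint : ∀ {y} → ¬ (y ∈ f x × y ∈ concatMap f xs)
    disjoint (y∈fx , y∈) with find (∈-concatMap⁻ f {xs = xs} y∈)
    ... | x′ , x′∈ , y∈fx′ = All.lookup x∉ x′∈ (trans (sym (tag≡ y∈fx)) (tag≡ y∈fx′))

  sum-constant : (f : X → ℕ) (c : ℕ) (xs : List X) → (∀ {x} → x ∈ xs → f x ≡ c) → sum (map f xs) ≡ length xs * c
  sum-constant f c []       f≡c = refl
  sum-constant f c (x ∷ xs) f≡c = cong₂ _+_ (f≡c (here refl)) (sum-constant f c xs (f≡c ∘ there))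

  sum-concatMap : (f : Y → ℕ) (g : X → List Y) (xs : List X) →
                  sum (map f (concatMap g xs)) ≡ sum (map (λ x → sum (map f (g x))) xs)
  sum-concatMap f g []       = refl
  sum-concatMap f g (x ∷ xs) = begin
    sum (map f (g x ++ concatMap g xs))            ≡⟨ cong sum (map-++ f (g x) (concatMap g xs)) ⟩
    sum (map f (g x) ++ map f (concatMap g xs))    ≡⟨ sum-++ (map f (g x)) _ ⟩
    sum (map f (g x)) + sum (map f (concatMap g xs)) ≡⟨ cong (sum (map f (g x)) +_) (sum-concatMap f g xs) ⟩
    sum (map f (g x)) + sum (map (λ x → sum (map f (g x))) xs) ∎
    where open ≡-Reasoning

  sum-map-+ : (f g : X → ℕ) (xs : List X) → sum (map (λ x → f x + g x) xs) ≡ sum (map f xs) + sum (map g xs)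
  sum-map-+ f g []       = refl
  sum-map-+ f g (x ∷ xs) = trans (cong (f x + g x +_) (sum-map-+ f g xs)) (lem (f x) (g x) (sum (map f xs)) (sum (map g xs)))
    where
    lem : ∀ a b c d → a + b + (c + d) ≡ a + c + (b + d)
    lem = solve-∀

  -- Coprimality of `h` and `g`; uniqueness and existence of normal forms.

  coprime-* : ∀ {a b c} → Coprime a b → Coprime a c → Coprime a (b * c)
  coprime-* a⊥b a⊥c (d∣a , d∣bc) =
    a⊥c (d∣a , coprime-divisor (λ (e∣d , e∣b) → a⊥b (∣-trans e∣d d∣a , e∣b)) d∣bc)

  module _ {k u v h} (N : Normal k u v h) where
    open Normal N

    private
      coprime-1+cg-g : Coprime (suc (c * g)) g
      coprime-1+cg-g {d} (d∣1+cg , d∣g) = ∣1⇒≡1 (∣m+n∣m⇒∣n (subst (d ∣_) (+-comm 1 (c * g)) d∣1+cg) (∣n⇒∣m*n c d∣g))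

      h∣1+cg : h ∣ suc (c * g)
      h∣1+cg = divides a (sym ah≡)

    -- `h` divides `1 + c g`, which is coprime to `g`.
    normal⇒coprime : Coprime h g
    normal⇒coprime (d∣h , d∣g) = coprime-1+cg-g (∣-trans d∣h h∣1+cg , d∣g)

    -- As `v` is odd, `⌈ v /2⌉` is `1 + c g`. This number is coprime to `g`, so its gcd with `h g`
    -- divides `h`, and `h` divides both. Hence `h` can be read off `v` and `k`.
    normal⇒gcd : gcd ⌈ v /2⌉ k ≡ h
    normal⇒gcd = trans (cong (λ z → gcd z k) ⌈v/2⌉≡) (∣-antisym d∣h (gcd-greatest h∣1+cg (divides g (trans k≡ (*-comm h g)))))
      where
      x = suc (c * g)
      d = gcd x k
      ⌈v/2⌉≡ : ⌈ v /2⌉ ≡ x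
      ⌈v/2⌉≡ = trans (cong ⌈_/2⌉ v≡) (cong suc (trans (cong (λ z → ⌊ c * g + z /2⌋) (+-identityʳ (c * g))) (sym (n≡⌊n+n/2⌋ (c * g)))))
      d∣h : d ∣ h
      d∣h = coprime-divisor {d} {g} (λ (e∣d , e∣g) → coprime-1+cg-g (∣-trans e∣d (gcd[m,n]∣m x k) , e∣g))
        (subst (d ∣_) (trans k≡ (*-comm h g)) (gcd[m,n]∣n x k))

  private
    -- The two multiples of `h` differ by `g e`, so `h ∣ e` by coprimality, while `e ≤ c + e < h`.
    -- Writing the larger residue as `c + e` avoids subtraction.
    residue-unique : ∀ {h g a a′} c e → Coprime h g → a * h ≡ suc (c * g) → a′ * h ≡ suc ((c + e) * g) → c + e < h → e ≡ 0
    residue-unique {h} {g} {a} {a′} c zero    _   _   _    _     = refl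
    residue-unique {h} {g} {a} {a′} c (suc e) h⊥g ah≡ a′h≡ c+e<h = contradiction
      (∣⇒≤ (coprime-divisor h⊥g (∣m+n∣m⇒∣n (divides a′ (sym (trans a′h≡ (lem c (suc e) g)))) (divides a (sym ah≡)))))
      (<⇒≱ (≤-<-trans (m≤n+m (suc e) c) c+e<h))
      where
      lem : ∀ c e g → suc ((c + e) * g) ≡ suc (c * g) + g * e
      lem = solve-∀

  -- `h` fixes `g = k / h`, and then `c` is the only residue below `h` with `c g ≡ -1` modulo `h`.
  normal-unique : ∀ {k u v v′ h} → Normal k u v h → Normal k u v′ h → v ≡ v′
  normal-unique {h = h} N@(normal g a c s k≡ ah≡ _ v≡ s<h c<h) (normal g′ a′ c′ _ k≡′ ah≡′ _ v≡′ _ c<h′) =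
    trans v≡ (trans (cong (λ z → suc (2 * z)) (cong₂ _*_ c≡c′ g≡g′)) (sym v≡′))
    where
    instance
      h≢0 : NonZero h
      h≢0 = >-nonZero (m<n⇒0<n s<h)
    g≡g′ : g ≡ g′
    g≡g′ = *-cancelˡ-≡ g g′ h (trans (sym k≡) k≡′)
    ah≡″ : a′ * h ≡ suc (c′ * g)
    ah≡″ = trans ah≡′ (cong (λ z → suc (c′ * z)) (sym g≡g′))
    c≡c′ : c ≡ c′
    c≡c′ with ≤-total c c′
    ... | inj₁ c≤c′ with m≤n⇒∃[o]m+o≡n c≤c′
    ...   | e , refl with residue-unique {a = a} {a′} c e (normal⇒coprime N) ah≡ ah≡″ c<h′
    ...     | refl = sym (+-identityʳ c)
    c≡c′ | inj₂ c′≤c with m≤n⇒∃[o]m+o≡n c′≤c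
    ...   | e , refl with residue-unique {a = a′} {a} c′ e (normal⇒coprime N) ah≡″ ah≡ c<h
    ...     | refl = +-identityʳ c′

  -- Take for `c` the residue modulo `h` of a solution of `g x ≡ -1`, which exists because
  -- `gcd g h = 1`.
  normal-exists : ∀ {h g s} → Coprime h g → s < h → ∃ λ v → Normal (h * g) (suc (2 * s) * g) v h
  normal-exists {h} {g} {s} h⊥g s<h = go (linear-congruence g h)
    where
    instance
      h≢0 : NonZero h
      h≢0 = >-nonZero (m<n⇒0<n s<h)
    go : ∃ (λ x → h ∣ g * x + gcd g h) → ∃ λ v → Normal (h * g) (suc (2 * s) * g) v h
    go (x , h∣gx+1) with subst (h ∣_) (begin
        g * x + gcd g h                      ≡⟨ cong₂ (λ y z → g * y + z) (m≡m%n+[m/n]*n x h) (Coprime.coprime⇒gcd≡1 (Coprime.sym h⊥g)) ⟩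
        g * (x % h + x / h * h) + 1          ≡⟨ lem g (x % h) (x / h) h ⟩
        g * (x / h) * h + suc (x % h * g)    ∎) h∣gx+1
      where
      open ≡-Reasoning
      lem : ∀ g r q h → g * (r + q * h) + 1 ≡ g * q * h + suc (r * g)
      lem = solve-∀
    ... | h∣ with ∣m+n∣m⇒∣n h∣ (n∣m*n (g * (x / h)))
    ...   | divides a eq = _ , normal g a (x % h) s refl (sym eq) refl refl s<h (m%n<n x h)

  -- Unitary divisors of `k` and of `2 k`.

  unitaryDivisors : ℕ → List ℕ
  unitaryDivisors k = map suc (filter (isUnitaryDivisor? k) (upTo k))

  unitaryDivisors-unique : ∀ k → Unique (unitaryDivisors k)
  unitaryDivisors-unique k = Unique.map⁺ suc-injective (Unique.filter⁺ (isUnitaryDivisor? k) (Unique.upTo⁺ k))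

  ∈-filter-unitary⁻ : ∀ {k i} → i ∈ filter (isUnitaryDivisor? k) (upTo k) →
                      suc i * (k / suc i) ≡ k × Coprime (suc i) (k / suc i)
  ∈-filter-unitary⁻ {k} i∈ with ∈-filter⁻ (isUnitaryDivisor? k) {xs = upTo k} i∈
  ... | _ , i∣k , coprime = m*[n/m]≡n i∣k , coprime

  ∈-unitaryDivisors⁻ : ∀ {k h} → h ∈ unitaryDivisors k → ∃ λ g → k ≡ h * g × Coprime h g
  ∈-unitaryDivisors⁻ {k} h∈ with ∈-map⁻ suc h∈
  ... | i , i∈ , refl with ∈-filter-unitary⁻ {k} i∈
  ...   | eq , coprime = k / suc i , sym eq , coprime

  [m*n]/m≡n : ∀ m n .{{_ : NonZero m}} → m * n / m ≡ n
  [m*n]/m≡n m n = trans (cong (_/ m) (*-comm m n)) (m*n/n≡m n m)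

  ∈-filter-unitary⁺ : ∀ {k i g} .{{_ : NonZero k}} → k ≡ suc i * g → Coprime (suc i) g → i ∈ filter (isUnitaryDivisor? k) (upTo k)
  ∈-filter-unitary⁺ {k} {i} {g} refl coprime = ∈-filter⁺ (isUnitaryDivisor? k) (∈-upTo⁺ (∣⇒≤ (m∣m*n g)))
    (m∣m*n g , subst (Coprime (suc i)) (sym ([m*n]/m≡n (suc i) g)) coprime)

  ∈-unitaryDivisors⁺ : ∀ {k h g} .{{_ : NonZero k}} → k ≡ h * g → Coprime h g → h ∈ unitaryDivisors k
  ∈-unitaryDivisors⁺ {k} {zero}  k≡ _       = contradiction k≡ (≢-nonZero⁻¹ k)
  ∈-unitaryDivisors⁺ {k} {suc i} k≡ coprime = ∈-map⁺ suc (∈-filter-unitary⁺ k≡ coprime)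

  iverson2∣-even : ∀ {n} → 2 ∣ n → iverson2∣ n ≡ 1
  iverson2∣-even {n} 2∣n with 2 ∣? n
  ... | yes _  = refl
  ... | no 2∤n = contradiction 2∣n 2∤n

  iverson2∣-odd : ∀ {n} → ¬ 2 ∣ n → iverson2∣ n ≡ 0
  iverson2∣-odd {n} 2∤n with 2 ∣? n
  ... | yes 2∣n = contradiction 2∣n 2∤n
  ... | no _    = refl

  -- Sends an even `d` to `2 d` and fixes an odd `d`. The additive form lets a sum over it split
  -- into the full sum and the sum over even `d`.
  evenPartDoubled : ℕ → ℕ
  evenPartDoubled d = d + d * iverson2∣ d

  evenPartDoubled-even : ∀ {d} → 2 ∣ d → evenPartDoubled d ≡ 2 * d
  evenPartDoubled-even {d} 2∣d = cong (d +_) (trans (cong (d *_) (iverson2∣-even 2∣d)) (*-comm d 1))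

  evenPartDoubled-odd : ∀ {d} → ¬ 2 ∣ d → evenPartDoubled d ≡ d
  evenPartDoubled-odd {d} 2∤d = trans (cong (λ z → d + d * z) (iverson2∣-odd 2∤d)) (trans (cong (d +_) (*-zeroʳ d)) (+-identityʳ d))

  even? : ∀ n → 2 ∣ n ⊎ ¬ 2 ∣ n
  even? n = toSum (2 ∣? n)

  -- The value has the parity of its argument, so the mixed cases are impossible.
  evenPartDoubled-injective : ∀ {d e} → evenPartDoubled d ≡ evenPartDoubled e → d ≡ e
  evenPartDoubled-injective {d} {e} eq with even? d | even? e
  ... | inj₁ 2∣d | inj₁ 2∣e = *-cancelˡ-≡ d e 2 (trans (sym (evenPartDoubled-even 2∣d)) (trans eq (evenPartDoubled-even 2∣e)))
  ... | inj₁ 2∣d | inj₂ 2∤e  = contradiction (divides d (trans (trans (sym (evenPartDoubled-odd 2∤e)) (trans (sym eq) (evenPartDoubled-even 2∣d))) (*-comm 2 d))) 2∤e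
  ... | inj₂ 2∤d  | inj₁ 2∣e = contradiction (divides e (trans (trans (sym (evenPartDoubled-odd 2∤d)) (trans eq (evenPartDoubled-even 2∣e))) (*-comm 2 e))) 2∤d
  ... | inj₂ 2∤d  | inj₂ 2∤e  = trans (sym (evenPartDoubled-odd 2∤d)) (trans eq (evenPartDoubled-odd 2∤e))

  odd⇒coprime-2 : ∀ {n} → ¬ 2 ∣ n → Coprime n 2
  odd⇒coprime-2 2∤n {0} (_ , 0∣2) = contradiction (0∣⇒≡0 0∣2) λ ()
  odd⇒coprime-2 2∤n {1} _ = refl
  odd⇒coprime-2 2∤n {2} (2∣n , _) = contradiction 2∣n 2∤n
  odd⇒coprime-2 2∤n {suc (suc (suc _))} (_ , d∣2) with ∣⇒≤ d∣2
  ... | s≤s (s≤s ())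

  -- For `k` even, exactly one of `d` and its coprime cofactor is even. The additional factor 2 of
  -- `2 k` must join that one for the two to remain coprime.
  unitaryDivisors-double : ∀ k .{{_ : NonZero k}} → 2 ∣ k → map evenPartDoubled (unitaryDivisors k) ↭ unitaryDivisors (2 * k)
  unitaryDivisors-double k 2∣k = unique∧set⇒↭ (Unique.map⁺ evenPartDoubled-injective (unitaryDivisors-unique k))
    (unitaryDivisors-unique (2 * k)) to from
    where
    instance
      2k≢0 : NonZero (2 * k)
      2k≢0 = m*n≢0 2 k

    to : ∀ {e} → e ∈ map evenPartDoubled (unitaryDivisors k) → e ∈ unitaryDivisors (2 * k)
    to e∈ with ∈-map⁻ evenPartDoubled e∈
    ... | d , d∈ , refl with ∈-unitaryDivisors⁻ {k} d∈ | even? d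
    ...   | g , k≡ , d⊥g | inj₁ 2∣d = subst (_∈ unitaryDivisors (2 * k)) (sym (evenPartDoubled-even 2∣d))
      (∈-unitaryDivisors⁺ (trans (cong (2 *_) k≡) (sym (*-assoc 2 d g))) (Coprime.sym (coprime-* (odd⇒coprime-2 2∤g) (Coprime.sym d⊥g))))
      where
      2∤g : ¬ 2 ∣ g
      2∤g 2∣g = contradiction (d⊥g (2∣d , 2∣g)) λ ()
    ...   | g , k≡ , d⊥g | inj₂ 2∤d = subst (_∈ unitaryDivisors (2 * k)) (sym (evenPartDoubled-odd 2∤d))
      (∈-unitaryDivisors⁺ (trans (cong (2 *_) k≡) (lem d g)) (coprime-* (odd⇒coprime-2 2∤d) d⊥g))
      where
      lem : ∀ d g → 2 * (d * g) ≡ d * (2 * g)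
      lem = solve-∀

    from : ∀ {e} → e ∈ unitaryDivisors (2 * k) → e ∈ map evenPartDoubled (unitaryDivisors k)
    from {e} e∈ with ∈-unitaryDivisors⁻ {2 * k} e∈ | even? e
    ... | g , 2k≡ , e⊥g | inj₁ (divides d refl) = subst (_∈ map evenPartDoubled (unitaryDivisors k)) (trans (evenPartDoubled-even 2∣d) (*-comm 2 d))
      (∈-map⁺ evenPartDoubled (∈-unitaryDivisors⁺ k≡ d⊥g))
      where
      k≡ : k ≡ d * g
      k≡ = *-cancelˡ-≡ k (d * g) 2 (trans 2k≡ (lem d g))
        where
        lem : ∀ d g → d * 2 * g ≡ 2 * (d * g)
        lem = solve-∀
      d⊥g : Coprime d g
      d⊥g (x∣d , x∣g) = e⊥g (∣m⇒∣m*n 2 x∣d , x∣g)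
      2∤g : ¬ 2 ∣ g
      2∤g 2∣g = contradiction (e⊥g (n∣m*n d , 2∣g)) λ ()
      -- The evenness of `k = d g` enters here: `g` is odd, so the factor 2 lies in `d`, and
      -- `e = 2 d` is the image of `d`.
      2∣d : 2 ∣ d
      2∣d = coprime-divisor (Coprime.sym (odd⇒coprime-2 2∤g)) (subst (2 ∣_) (trans k≡ (*-comm d g)) 2∣k)
    -- With `e` odd, the factor 2 lies in the cofactor, and halving the cofactor exhibits `e` itself
    -- as a unitary divisor of `k`.
    ... | g , 2k≡ , e⊥g | inj₂ 2∤e with coprime-divisor (Coprime.sym (odd⇒coprime-2 2∤e)) (subst (2 ∣_) 2k≡ (m∣m*n k))
    ...   | divides g′ refl = subst (_∈ map evenPartDoubled (unitaryDivisors k)) (evenPartDoubled-odd 2∤e)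
      (∈-map⁺ evenPartDoubled (∈-unitaryDivisors⁺ {g = g′} (*-cancelˡ-≡ k (e * g′) 2 (trans 2k≡ (lem e g′)))
        (λ (x∣e , x∣g′) → e⊥g (x∣e , ∣m⇒∣m*n 2 x∣g′))))
      where
      lem : ∀ e g → e * (g * 2) ≡ 2 * (e * g)
      lem = solve-∀

  -- `s1*` is by definition the sum of `unitaryDivisors`, so the permutation above transports it to
  -- a sum of `evenPartDoubled`.
  s1*-double : ∀ k .{{_ : NonZero k}} → 2 ∣ k →
               s1* (2 * k) ≡ s1* k + sum (map (λ d → d * iverson2∣ d) (unitaryDivisors k))
  s1*-double k 2∣k = begin
    sum (unitaryDivisors (2 * k))                    ≡⟨ sum-↭ (unitaryDivisors-double k 2∣k) ⟨
    sum (map evenPartDoubled (unitaryDivisors k))    ≡⟨ sum-map-+ id (λ d → d * iverson2∣ d) (unitaryDivisors k) ⟩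
    sum (map id (unitaryDivisors k)) + sum (map (λ d → d * iverson2∣ d) (unitaryDivisors k))
      ≡⟨ cong (λ z → sum z + sum (map (λ d → d * iverson2∣ d) (unitaryDivisors k))) (map-id (unitaryDivisors k)) ⟩
    s1* k + sum (map (λ d → d * iverson2∣ d) (unitaryDivisors k)) ∎
    where open ≡-Reasoning

  -- Weighted counts of quasipolarities.

  unitaryPart : ℕ → ℕ × ℕ → ℕ
  unitaryPart k (_ , v) = gcd ⌈ v /2⌉ k

  -- An abstract setting for the count: `qs` stands for `Q k`, `part` for `unitaryPart k`, `is` for
  -- the indices `i` with `suc i` a unitary divisor, and `cofactor i` for `k / suc i`.
  module _ {k} .{{_ : NonZero k}} {qs : List (ℕ × ℕ)} (qs! : Unique qs) (part : ℕ × ℕ → ℕ)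
           (sound : ∀ {u v} → (u , v) ∈ qs → Normal k u v (part (u , v)))
           (complete : ∀ {u v h} → Normal k u v h → (u , v) ∈ qs)
           (part≡ : ∀ {u v h} → Normal k u v h → part (u , v) ≡ h)
           {is : List ℕ} (is! : Unique is) (cofactor : ℕ → ℕ)
           (unitary⁻ : ∀ {i} → i ∈ is → suc i * cofactor i ≡ k × Coprime (suc i) (cofactor i))
           (unitary⁺ : ∀ {i g} → k ≡ suc i * g → Coprime (suc i) g → i ∈ is × cofactor i ≡ g) where

    private
      -- A quasipolarity is recorded by `(h , u)`; by `normal-unique` the coefficient `v` can be
      -- recovered from it.
      code : ℕ × ℕ → ℕ × ℕ
      code (u , v) = part (u , v) , u

      -- The codes with `h = suc i`: `u` is an odd multiple of `g`, one for each of the `h` values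
      -- of `s`.
      fiber : ℕ → List (ℕ × ℕ)
      fiber i = map (λ s → suc i , suc (2 * s) * cofactor i) (upTo (suc i))

      codes : List (ℕ × ℕ)
      codes = concatMap fiber is

      code-injective : ∀ {p q} → p ∈ qs → q ∈ qs → code p ≡ code q → p ≡ q
      code-injective {u , v} {u′ , v′} p∈ q∈ eq = cong₂ _,_ u≡u′ (normal-unique (sound p∈)
        (subst₂ (λ u h → Normal k u v′ h) (sym u≡u′) (sym (cong proj₁ eq)) (sound q∈)))
        where
        u≡u′ : u ≡ u′
        u≡u′ = cong proj₂ eq

      fiber-unique : ∀ {i} → i ∈ is → Unique (fiber i)
      fiber-unique {i} i∈ = Unique.map⁺ injective (Unique.upTo⁺ (suc i))
        where
        instance
          g≢0 : NonZero (cofactor i)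
          g≢0 = ≢-nonZero λ g≡0 → ≢-nonZero⁻¹ k (trans (sym (proj₁ (unitary⁻ i∈))) (trans (cong (suc i *_) g≡0) (*-zeroʳ (suc i))))
        injective : ∀ {s t} → (suc i , suc (2 * s) * cofactor i) ≡ (suc i , suc (2 * t) * cofactor i) → s ≡ t
        injective {s} {t} eq = *-cancelˡ-≡ s t 2 (suc-injective (*-cancelʳ-≡ (suc (2 * s)) (suc (2 * t)) (cofactor i) (cong proj₂ eq)))

      fiber-tag : ∀ {i p} → p ∈ fiber i → pred (proj₁ p) ≡ i
      fiber-tag {i} p∈ with ∈-map⁻ (λ s → suc i , suc (2 * s) * cofactor i) {xs = upTo (suc i)} p∈
      ... | _ , _ , refl = refl

      normal⇒code : ∀ {u v h} → Normal k u v h → (h , u) ∈ codes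
      normal⇒code {h = suc i} N@(normal g _ _ s k≡ _ refl _ s<h _) =
        ∈-concatMap⁺ fiber (lose (proj₁ i∈,cof≡) (subst (λ z → (suc i , suc (2 * s) * z) ∈ fiber i) (proj₂ i∈,cof≡)
          (∈-map⁺ (λ s → suc i , suc (2 * s) * cofactor i) (∈-upTo⁺ s<h))))
        where i∈,cof≡ = unitary⁺ k≡ (normal⇒coprime N)

      to : ∀ {z} → z ∈ map code qs → z ∈ codes
      to z∈ with ∈-map⁻ code z∈
      ... | _ , uv∈ , refl = normal⇒code (sound uv∈)

      fiber⇒code : ∀ {i s} → i ∈ is → s < suc i → (suc i , suc (2 * s) * cofactor i) ∈ map code qs
      fiber⇒code {i} {s} i∈ s<h = subst (_∈ map code qs) (cong (_, u) (part≡ N)) (∈-map⁺ code (complete N))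
        where
        u = suc (2 * s) * cofactor i
        vN = normal-exists {s = s} (proj₂ (unitary⁻ i∈)) s<h
        N : Normal k u (proj₁ vN) (suc i)
        N = subst (λ z → Normal z u (proj₁ vN) (suc i)) (proj₁ (unitary⁻ i∈)) (proj₂ vN)

      from : ∀ {z} → z ∈ codes → z ∈ map code qs
      from z∈ with find (∈-concatMap⁻ fiber {xs = is} z∈)
      ... | i , i∈ , z∈fiber with ∈-map⁻ (λ s → suc i , suc (2 * s) * cofactor i) {xs = upTo (suc i)} z∈fiber
      ...   | s , s∈ , refl = fiber⇒code {s = s} i∈ (∈-upTo⁻ s∈)

      codes-↭ : map code qs ↭ codes
      codes-↭ = unique∧set⇒↭ (map-unique code code-injective qs!)
        (concatMap-unique fiber (pred ∘ proj₁) is fiber-unique fiber-tag is!)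
        to from

    -- The codes are regrouped by `h`; the fiber over `h` has `h` elements, and the weight is
    -- constant on it.
    sum-unitaryPart : (f : ℕ → ℕ) → sum (map (f ∘ part) qs) ≡ sum (map (λ i → suc i * f (suc i)) is)
    sum-unitaryPart f = begin
      sum (map (f ∘ part) qs)         ≡⟨ cong sum (map-∘ qs) ⟩
      sum (map (f ∘ proj₁) (map code qs))      ≡⟨ sum-↭ (map⁺ (f ∘ proj₁) codes-↭) ⟩
      sum (map (f ∘ proj₁) codes)                 ≡⟨ sum-concatMap (f ∘ proj₁) fiber is ⟩
      sum (map (λ i → sum (map (f ∘ proj₁) (fiber i))) is) ≡⟨ cong sum (map-cong fiber-sum is) ⟩
      sum (map (λ i → suc i * f (suc i)) is)      ∎
      where
      open ≡-Reasoning
      fiber-sum : ∀ i → sum (map (f ∘ proj₁) (fiber i)) ≡ suc i * f (suc i)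
      fiber-sum i = begin
        sum (map (f ∘ proj₁) (fiber i))           ≡⟨ cong sum (map-∘ (upTo (suc i))) ⟨
        sum (map (λ _ → f (suc i)) (upTo (suc i))) ≡⟨ sum-constant _ (f (suc i)) (upTo (suc i)) (λ _ → refl) ⟩
        length (upTo (suc i)) * f (suc i)         ≡⟨ cong (_* f (suc i)) (length-upTo (suc i)) ⟩
        suc i * f (suc i)                         ∎

  module _ {m : ℕ} where

    private
      k = suc m

    ∈-Q⁻ : ∀ {u v} → (u , v) ∈ Q k → Normal k u v (unitaryPart k (u , v))
    ∈-Q⁻ {u} {v} uv∈ = subst (Normal k u v) (sym (normal⇒gcd (proj₂ hN))) (proj₂ hN)
      where
      uv∈×,quasi = ∈-filter⁻ (isQuasipolarity? m) {xs = cartesianProduct (upTo (2 * k)) (upTo (2 * k))} uv∈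
      u∈,v∈ = ∈-cartesianProduct⁻ (upTo (2 * k)) (upTo (2 * k)) (proj₁ uv∈×,quasi)
      hN : ∃ (Normal k u v)
      hN = quasipolarity⇒normal (∈-upTo⁻ (proj₁ u∈,v∈)) (∈-upTo⁻ (proj₂ u∈,v∈)) (proj₂ uv∈×,quasi)

    ∈-Q⁺ : ∀ {u v h} → Normal k u v h → (u , v) ∈ Q k
    ∈-Q⁺ N = ∈-filter⁺ (isQuasipolarity? m)
      (∈-cartesianProduct⁺ (∈-upTo⁺ (normal⇒u<n N)) (∈-upTo⁺ (normal⇒v<n N))) (normal⇒quasipolarity N)

  Q-unique : ∀ k → Unique (Q k)
  Q-unique zero    = []
  Q-unique (suc m) = Unique.filter⁺ (isQuasipolarity? m) (Unique.cartesianProduct⁺ (Unique.upTo⁺ (2 * suc m)) (Unique.upTo⁺ (2 * suc m)))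

  -- The weight 1 gives the cardinality of `Q k`; the weight `iverson2∣` gives the value of the
  -- field sum.
  sum-Q : ∀ k (f : ℕ → ℕ) → sum (map (f ∘ unitaryPart k) (Q k)) ≡ sum (map (λ d → d * f d) (unitaryDivisors k))
  sum-Q zero      f = refl
  sum-Q k@(suc m) f = trans
    (sum-unitaryPart (Q-unique k) (unitaryPart k) ∈-Q⁻ ∈-Q⁺ normal⇒gcd
      (Unique.filter⁺ (isUnitaryDivisor? k) (Unique.upTo⁺ k)) (λ i → k / suc i) (∈-filter-unitary⁻ {k})
      (λ {i} {g} k≡ coprime → ∈-filter-unitary⁺ k≡ coprime , trans (cong (_/ suc i) k≡) ([m*n]/m≡n (suc i) g)) f)
    (cong sum (map-∘ (filter (isUnitaryDivisor? k) (upTo k))))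

  length-Q : ∀ k → length (Q k) ≡ s1* k
  length-Q k = begin
    length (Q k)                                ≡⟨ *-identityʳ _ ⟨
    length (Q k) * 1                            ≡⟨ sum-constant (λ _ → 1) 1 (Q k) (λ _ → refl) ⟨
    sum (map (λ _ → 1) (Q k))                   ≡⟨ sum-Q k (λ _ → 1) ⟩
    sum (map (_* 1) (unitaryDivisors k))        ≡⟨ cong sum (map-cong *-identityʳ (unitaryDivisors k)) ⟩
    sum (map id (unitaryDivisors k))            ≡⟨ cong sum (map-id (unitaryDivisors k)) ⟩
    s1* k                                       ∎
    where open ≡-Reasoning

-- Roots of unity and finite products in the field.

module FieldProducts {ℓ₁ ℓ₂} (F : CharZeroField ℓ₁ ℓ₂) where

  open Arithmetic
  open Counting
  open import Data.Nat using (ℕ; zero; suc; _<_; _∸_; _%_; _/_; NonZero; s≤s; z<s)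
  import Data.Nat as ℕ
  import Data.Nat.Properties as ℕ
  open import Data.Nat.DivMod using (m≡m%n+[m/n]*n; m%n≤n; m%n<n)
  open import Data.Nat.Divisibility using (_∣_; divides; m%n≡0⇒n∣m; n∣m*n; ∣m⇒∣m*n)
  open import Data.Nat.ListAction using (sum)
  open import Data.Nat.Tactic.RingSolver using (solve-∀)
  open import Data.List using (List; []; _∷_; map; foldr; applyUpTo; upTo; length)
  open import Data.List.Properties using (map-upTo)
  open import Data.List.Membership.Propositional using (_∈_)
  open import Data.List.Membership.Propositional.Properties using (∈-upTo⁺)
  open import Data.List.Relation.Unary.Any using (here; there)
  open import Data.Product using (_,_; proj₁; proj₂)
  open import Data.Sum using (_⊎_; inj₁; inj₂)
  open import Function using (_∘_)
  open import Relation.Nullary using (¬_)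
  open import Relation.Binary.PropositionalEquality as ≡ using (_≡_)
  open CharZeroField F
  open import Algebra.Properties.Ring ring
    using (-‿distribʳ-*; x∙y⁻¹≈ε⇒x≈y; +-inverseʳ-unique; [y-z]x≈yx-zx; xyx⁻¹≈y)
  open import Algebra.Properties.CommutativeSemigroup *-commutativeSemigroup using (interchange; x∙yz≈y∙xz)
  open import Relation.Binary.Reasoning.Setoid setoid

  ^-+ : ∀ x m n → x ^ (m ℕ.+ n) ≈ x ^ m * x ^ n
  ^-+ x zero    n = sym (*-identityˡ _)
  ^-+ x (suc m) n = trans (*-congˡ (^-+ x m n)) (sym (*-assoc x (x ^ m) (x ^ n)))

  ^-∣ : ∀ {x n m} → x ^ n ≈ 1# → n ∣ m → x ^ m ≈ 1#
  ^-∣ {x} {n} xⁿ≈1 (divides q ≡.refl) = go q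
    where
    go : ∀ q → x ^ (q ℕ.* n) ≈ 1#
    go zero    = refl
    go (suc q) = trans (^-+ x n (q ℕ.* n)) (trans (*-cong xⁿ≈1 (go q)) (*-identityˡ 1#))

  primitive-∣ : ∀ {n ζ m} .{{_ : NonZero n}} → IsPrimitiveRoot n ζ → ζ ^ m ≈ 1# → n ∣ m
  primitive-∣ {n} {ζ} {m} (ζⁿ≈1 , minimal) ζᵐ≈1 = m%n≡0⇒n∣m m n (ℕ.n≤0⇒n≡0 (ℕ.≮⇒≥ λ 0<r → minimal (m % n) 0<r (m%n<n m n) ζʳ≈1))
    where
    ζʳ≈1 : ζ ^ (m % n) ≈ 1#
    ζʳ≈1 = begin
      ζ ^ (m % n)                              ≈⟨ *-identityʳ _ ⟨
      ζ ^ (m % n) * 1#                         ≈⟨ *-congˡ (^-∣ {ζ} ζⁿ≈1 (n∣m*n (m / n))) ⟨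
      ζ ^ (m % n) * ζ ^ ((m / n) ℕ.* n)        ≈⟨ ^-+ ζ (m % n) _ ⟨
      ζ ^ (m % n ℕ.+ (m / n) ℕ.* n)            ≡⟨ ≡.cong (ζ ^_) (m≡m%n+[m/n]*n m n) ⟨
      ζ ^ m                                    ≈⟨ ζᵐ≈1 ⟩
      1#                                       ∎

  -- Powers of `ζ` whose exponents stand for negative residues are compared below through a common
  -- inverse.
  inverse-unique : ∀ {x y z} → x * z ≈ 1# → y * z ≈ 1# → x ≈ y
  inverse-unique {x} {y} {z} xz≈1 yz≈1 = begin
    x            ≈⟨ *-identityʳ x ⟨
    x * 1#       ≈⟨ *-congˡ yz≈1 ⟨
    x * (y * z)  ≈⟨ x∙yz≈y∙xz x y z ⟩
    y * (x * z)  ≈⟨ *-congˡ xz≈1 ⟩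
    y * 1#       ≈⟨ *-identityʳ y ⟩
    y            ∎

  -- `1 - x` is invertible and annihilates `1 + x`.
  x²≈1⇒x≈-1 : ∀ {x} → x * x ≈ 1# → ¬ (x ≈ 1#) → x ≈ - 1#
  x²≈1⇒x≈-1 {x} x²≈1 x≉1 = +-inverseʳ-unique 1# x (begin
    1# + x                        ≈⟨ *-identityˡ _ ⟨
    1# * (1# + x)                 ≈⟨ *-congʳ (⁻¹-inverse (1# - x) 1-x≉0) ⟨
    (1# - x) * (1# - x) ⁻¹ * (1# + x) ≈⟨ *-congʳ (*-comm _ _) ⟩
    (1# - x) ⁻¹ * (1# - x) * (1# + x) ≈⟨ *-assoc _ _ _ ⟩
    (1# - x) ⁻¹ * ((1# - x) * (1# + x)) ≈⟨ *-congˡ 1-x² ⟩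
    (1# - x) ⁻¹ * 0#              ≈⟨ zeroʳ _ ⟩
    0#                            ∎)
    where
    1-x≉0 : ¬ (1# - x ≈ 0#)
    1-x≉0 1-x≈0 = x≉1 (sym (x∙y⁻¹≈ε⇒x≈y 1# x 1-x≈0))
    1-x² : (1# - x) * (1# + x) ≈ 0#
    1-x² = begin
      (1# - x) * (1# + x)              ≈⟨ [y-z]x≈yx-zx (1# + x) 1# x ⟩
      1# * (1# + x) - x * (1# + x)     ≈⟨ +-cong (*-identityˡ _) (-‿cong (distribˡ x 1# x)) ⟩
      1# + x - (x * 1# + x * x)        ≈⟨ +-congˡ (-‿cong (trans (+-cong (*-identityʳ x) x²≈1) (+-comm x 1#))) ⟩
      1# + x - (1# + x)                ≈⟨ -‿inverseʳ _ ⟩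
      0#                               ∎

  ofℕ-+ : ∀ m n → ofℕ (m ℕ.+ n) ≈ ofℕ m + ofℕ n
  ofℕ-+ zero    n = sym (+-identityˡ _)
  ofℕ-+ (suc m) n = trans (+-congˡ (ofℕ-+ m n)) (sym (+-assoc 1# (ofℕ m) (ofℕ n)))

  module _ {ℓ} {X : Set ℓ} where

    sum-ofℕ : (f : X → Carrier) (g : X → ℕ) (xs : List X) → (∀ {x} → x ∈ xs → f x ≈ ofℕ (g x)) →
              foldr _+_ 0# (map f xs) ≈ ofℕ (sum (map g xs))
    sum-ofℕ f g []       f≈g = refl
    sum-ofℕ f g (x ∷ xs) f≈g =
      trans (+-cong (f≈g (here ≡.refl)) (sum-ofℕ f g xs (f≈g ∘ there))) (sym (ofℕ-+ (g x) (sum (map g xs))))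

    product-zero : (f : X → Carrier) {xs : List X} {x : X} → x ∈ xs → f x ≈ 0# → foldr _*_ 1# (map f xs) ≈ 0#
    product-zero f (here ≡.refl) fx≈0 = trans (*-congʳ fx≈0) (zeroˡ _)
    product-zero f (there x∈)    fx≈0 = trans (*-congˡ (product-zero f x∈ fx≈0)) (zeroʳ _)

  -- With `applyUpTo`, the product unfolds by shifting `f`, which suits induction on `n`; `map-upTo`
  -- links it to the products in `quasiSum`.
  ∏ : ℕ → (ℕ → Carrier) → Carrier
  ∏ n f = foldr _*_ 1# (applyUpTo f n)

  ∏-cong : ∀ {f g} n → (∀ i → f i ≈ g i) → ∏ n f ≈ ∏ n g
  ∏-cong zero    f≈g = refl
  ∏-cong (suc n) f≈g = *-cong (f≈g 0) (∏-cong n (f≈g ∘ suc))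

  ∏-* : ∀ f g n → ∏ n (λ i → f i * g i) ≈ ∏ n f * ∏ n g
  ∏-* f g zero    = sym (*-identityˡ 1#)
  ∏-* f g (suc n) = trans (*-congˡ (∏-* (f ∘ suc) (g ∘ suc) n)) (interchange _ _ _ _)

  ∏-1 : ∀ n → ∏ n (λ _ → 1#) ≈ 1#
  ∏-1 zero    = refl
  ∏-1 (suc n) = trans (*-identityˡ _) (∏-1 n)

  ∏-last : ∀ f n → ∏ (suc n) f ≈ ∏ n f * f n
  ∏-last f zero    = *-comm (f 0) 1#
  ∏-last f (suc n) = trans (*-congˡ (∏-last (f ∘ suc) n)) (sym (*-assoc _ _ _))

  -- Raising the offset by one removes the first factor `f t` and appends `f (n + t)`, which equals
  -- it by periodicity.
  ∏-shift : ∀ {f} n → (∀ i → f (n ℕ.+ i) ≈ f i) → ∀ t → ∏ n (λ i → f (t ℕ.+ i)) ≈ ∏ n f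
  ∏-shift {f} n periodic zero    = refl
  ∏-shift {f} n periodic (suc t) = trans (step n periodic) (∏-shift n periodic t)
    where
    step : ∀ n → (∀ i → f (n ℕ.+ i) ≈ f i) → ∏ n (λ i → f (suc t ℕ.+ i)) ≈ ∏ n (λ i → f (t ℕ.+ i))
    step zero    _        = refl
    step (suc n) periodic = begin
      ∏ (suc n) (λ i → f (suc t ℕ.+ i))                 ≈⟨ ∏-last (λ i → f (suc t ℕ.+ i)) n ⟩
      ∏ n (λ i → f (suc t ℕ.+ i)) * f (suc t ℕ.+ n)     ≈⟨ *-comm _ _ ⟩
      f (suc t ℕ.+ n) * ∏ n (λ i → f (suc t ℕ.+ i))     ≈⟨ *-cong last (∏-cong n λ i → reflexive (≡.cong f (≡.sym (ℕ.+-suc t i)))) ⟩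
      f (t ℕ.+ 0) * ∏ n (λ i → f (t ℕ.+ suc i))         ∎
      where
      last : f (suc t ℕ.+ n) ≈ f (t ℕ.+ 0)
      last = trans (reflexive (≡.cong (f ∘ suc) (ℕ.+-comm t n))) (trans (periodic t) (reflexive (≡.cong f (≡.sym (ℕ.+-identityʳ t)))))

  -- Exchanging the product of the numerators for that of the denominators pairs each `g i` with its
  -- own inverse.
  ∏-÷ : ∀ n f g → (∀ i → ¬ (g i ≈ 0#)) → ∏ n f ≈ ∏ n g → ∏ n (λ i → f i ÷ g i) ≈ 1#
  ∏-÷ n f g g≉0 f≈g = begin
    ∏ n (λ i → f i ÷ g i)            ≈⟨ ∏-* f (λ i → g i ⁻¹) n ⟩
    ∏ n f * ∏ n (λ i → g i ⁻¹)       ≈⟨ *-congʳ f≈g ⟩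
    ∏ n g * ∏ n (λ i → g i ⁻¹)       ≈⟨ ∏-* g (λ i → g i ⁻¹) n ⟨
    ∏ n (λ i → g i ÷ g i)            ≈⟨ ∏-cong n (λ i → ⁻¹-inverse (g i) (g≉0 i)) ⟩
    ∏ n (λ _ → 1#)                   ≈⟨ ∏-1 n ⟩
    1#                               ∎

  -- The product attached to one quasipolarity, and the sum of these products.

  module _ {m ζ} (ζ-primitive : IsPrimitiveRoot (2 ℕ.* suc m) ζ) where

    private
      k = suc m
      n = 2 ℕ.* k
      ζⁿ≈1 = proj₁ ζ-primitive

      ζ^-inverse : ∀ {e x} → n ∣ e ℕ.+ x → ζ ^ e * ζ ^ x ≈ 1#
      ζ^-inverse {e} {x} n∣e+x = trans (sym (^-+ ζ e x)) (^-∣ {ζ} ζⁿ≈1 n∣e+x)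

    ζᵏζᵏ≈1 : ζ ^ k * ζ ^ k ≈ 1#
    ζᵏζᵏ≈1 = ζ^-inverse {k} {k} (divides 1 (lem k))
      where
      lem : ∀ k → k ℕ.+ k ≡ 1 ℕ.* (2 ℕ.* k)
      lem = solve-∀

    ζᵏ≈-1 : ζ ^ k ≈ - 1#
    ζᵏ≈-1 = x²≈1⇒x≈-1 ζᵏζᵏ≈1 (proj₂ ζ-primitive k z<s (ℕ.m<m+n k z<s))

    module _ {u v h} (N : Normal k u v h) where
      open Normal N

      private
        -- `X j` represents `π(j) - j` modulo `2 k`, while `ε j` is the exponent occurring in
        -- `quasiSum`; the two are opposite modulo `2 k`.
        X : ℕ → ℕ
        X j = 2 ℕ.* (c ℕ.* g) ℕ.* j ℕ.+ u

        ε : ℕ → ℕ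
        ε j = j ℕ.+ (n ∸ aff m u v j)

        E : ℕ → Carrier
        E j = ζ ^ ε j

        n∣ε+X : ∀ j → n ∣ ε j ℕ.+ X j
        -- Adding `j + r` to both sides lets `r` recombine with the truncated difference `n ∸ r`.
        n∣ε+X j = divides (suc q) (ℕ.+-cancelˡ-≡ (j ℕ.+ r) _ _ (≡-R.begin
          j ℕ.+ r ℕ.+ (ε j ℕ.+ X j)                 ≡-R.≡⟨ lem j r (n ∸ r) (X j) ⟩
          (j ℕ.+ (r ℕ.+ (n ∸ r))) ℕ.+ (j ℕ.+ X j)   ≡-R.≡⟨ ≡.cong₂ (λ y z → (j ℕ.+ y) ℕ.+ z) (ℕ.m+[n∸m]≡n (m%n≤n (v ℕ.* j ℕ.+ u) n)) j+X≡ ⟩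
          (j ℕ.+ n) ℕ.+ (r ℕ.+ q ℕ.* n)             ≡-R.≡⟨ lem′ j n r (q ℕ.* n) ⟩
          j ℕ.+ r ℕ.+ suc q ℕ.* n                   ≡-R.∎))
          where
          module ≡-R = ≡.≡-Reasoning
          r = aff m u v j
          q = (v ℕ.* j ℕ.+ u) / n
          j+X≡ : j ℕ.+ X j ≡ r ℕ.+ q ℕ.* n
          j+X≡ = ≡.trans (≡.sym (vx+u≡ N j)) (m≡m%n+[m/n]*n (v ℕ.* j ℕ.+ u) n)
          lem : ∀ j r d x → j ℕ.+ r ℕ.+ (j ℕ.+ d ℕ.+ x) ≡ (j ℕ.+ (r ℕ.+ d)) ℕ.+ (j ℕ.+ x)
          lem = solve-∀
          lem′ : ∀ j n r p → (j ℕ.+ n) ℕ.+ (r ℕ.+ p) ≡ j ℕ.+ r ℕ.+ (n ℕ.+ p)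
          lem′ = solve-∀

        EζX≈1 : ∀ j → E j * ζ ^ X j ≈ 1#
        EζX≈1 j = ζ^-inverse {ε j} {X j} (n∣ε+X j)

        -- If a denominator vanished, `ζ ^ X j` would be 1, and primitivity would force `n ∣ X j`.
        1-E≉0 : ∀ j → ¬ (1# - E j ≈ 0#)
        1-E≉0 j 1-E≈0 = n∤2cgx+u N j (primitive-∣ ζ-primitive (begin
          ζ ^ X j         ≈⟨ *-identityˡ _ ⟨
          1# * ζ ^ X j    ≈⟨ *-congʳ (x∙y⁻¹≈ε⇒x≈y 1# (E j) 1-E≈0) ⟩
          E j * ζ ^ X j   ≈⟨ EζX≈1 j ⟩
          1#              ∎))

        -- Moving `j` by `i` adds `2 c g i` to `π(j) - j`; both sides are inverse to `ζ ^ X j`.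
        E-shift : ∀ i j → E j ≈ E (i ℕ.+ j) * ζ ^ (2 ℕ.* (c ℕ.* g) ℕ.* i)
        E-shift i j = inverse-unique (EζX≈1 j) (begin
          E (i ℕ.+ j) * ζ ^ Y * ζ ^ X j      ≈⟨ *-assoc _ _ _ ⟩
          E (i ℕ.+ j) * (ζ ^ Y * ζ ^ X j)    ≈⟨ *-congˡ (^-+ ζ Y (X j)) ⟨
          E (i ℕ.+ j) * ζ ^ (Y ℕ.+ X j)      ≡⟨ ≡.cong (λ z → E (i ℕ.+ j) * ζ ^ z) (lem (2 ℕ.* (c ℕ.* g)) i j u) ⟩
          E (i ℕ.+ j) * ζ ^ X (i ℕ.+ j)      ≈⟨ EζX≈1 (i ℕ.+ j) ⟩
          1#                                 ∎)
          where
          Y = 2 ℕ.* (c ℕ.* g) ℕ.* i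
          lem : ∀ p i j u → p ℕ.* i ℕ.+ (p ℕ.* j ℕ.+ u) ≡ p ℕ.* (i ℕ.+ j) ℕ.+ u
          lem = solve-∀

        E-periodic : ∀ j → E (n ℕ.+ j) ≈ E j
        E-periodic j = sym (trans (E-shift n j) (trans (*-congˡ (^-∣ {ζ} ζⁿ≈1 (n∣m*n (2 ℕ.* (c ℕ.* g))))) (*-identityʳ _)))

      factor : ℕ → Carrier
      factor j = (1# + E j) ÷ (1# - E j)

      -- The exponent j - π(j) takes the value k at j = (b + s + 1) g, as 1 + c g = a h.
      product-odd : ∀ {b} → h ≡ suc (2 ℕ.* b) → foldr _*_ 1# (map factor (upTo n)) ≈ 0#
      product-odd {b} h≡ = product-zero factor (∈-upTo⁺ j<n) (trans (*-congʳ 1+E≈0) (zeroˡ _))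
        where
        -- The odd multiples `(2 b + 1) g = k` and `(2 s + 1) g = u` add up to `2 t g`; with
        -- `j = t g` this makes `k + X j = 2 t g (1 + c g) = a t n`.
        t = suc (b ℕ.+ s)
        j = t ℕ.* g
        instance
          g≢0 : NonZero g
          g≢0 = normal⇒g≢0 N
        j<n : j < n
        -- `b < h` and `s < h` give `t < 2 h`, and `n = 2 h g`.
        j<n = ≡.subst (j <_) (≡.sym (n≡ N)) (ℕ.*-monoˡ-< g (ℕ.≤-<-trans (ℕ.≤-reflexive (≡.sym (ℕ.+-suc b s)))
          (ℕ.<-≤-trans (ℕ.+-mono-<-≤ (≡.subst (b <_) (≡.sym h≡) (s≤s (ℕ.m≤n*m b 2))) s<h) (ℕ.≤-reflexive (≡.cong (h ℕ.+_) (≡.sym (ℕ.+-identityʳ h)))))))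
        n∣k+X : n ∣ k ℕ.+ X j
        n∣k+X = divides (a ℕ.* t) (≡-R.begin
          k ℕ.+ X j                                           ≡-R.≡⟨ ≡.cong₂ (λ y z → y ℕ.+ (2 ℕ.* (c ℕ.* g) ℕ.* j ℕ.+ z)) (≡.trans k≡ (≡.cong (ℕ._* g) h≡)) u≡ ⟩
          suc (2 ℕ.* b) ℕ.* g ℕ.+ (2 ℕ.* (c ℕ.* g) ℕ.* j ℕ.+ suc (2 ℕ.* s) ℕ.* g) ≡-R.≡⟨ lem b g c s ⟩
          suc (c ℕ.* g) ℕ.* (2 ℕ.* t ℕ.* g)                   ≡-R.≡⟨ ≡.cong (ℕ._* (2 ℕ.* t ℕ.* g)) ah≡ ⟨
          a ℕ.* h ℕ.* (2 ℕ.* t ℕ.* g)                         ≡-R.≡⟨ lem′ a h t g ⟩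
          a ℕ.* t ℕ.* (2 ℕ.* h ℕ.* g)                         ≡-R.≡⟨ ≡.cong (a ℕ.* t ℕ.*_) (n≡ N) ⟨
          a ℕ.* t ℕ.* n                                       ≡-R.∎)
          where
          module ≡-R = ≡.≡-Reasoning
          lem : ∀ b g c s → suc (2 ℕ.* b) ℕ.* g ℕ.+ (2 ℕ.* (c ℕ.* g) ℕ.* (suc (b ℕ.+ s) ℕ.* g) ℕ.+ suc (2 ℕ.* s) ℕ.* g)
                            ≡ suc (c ℕ.* g) ℕ.* (2 ℕ.* suc (b ℕ.+ s) ℕ.* g)
          lem = solve-∀
          lem′ : ∀ a h t g → a ℕ.* h ℕ.* (2 ℕ.* t ℕ.* g) ≡ a ℕ.* t ℕ.* (2 ℕ.* h ℕ.* g)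
          lem′ = solve-∀
        1+E≈0 : 1# + E j ≈ 0#
        1+E≈0 = trans (+-congˡ (trans (inverse-unique (EζX≈1 j) (ζ^-inverse {k} {X j} n∣k+X)) ζᵏ≈-1)) (-‿inverseʳ 1#)

      -- The shift j ↦ j + b g changes the exponent j - π(j) by k, so it turns each numerator into a denominator.
      product-even : ∀ {b} → h ≡ 2 ℕ.* b → foldr _*_ 1# (map factor (upTo n)) ≈ 1#
      product-even {b} h≡ = trans (reflexive (≡.cong (foldr _*_ 1#) (map-upTo factor n)))
        (∏-÷ n (λ j → 1# + E j) (λ j → 1# - E j) 1-E≉0 (trans (∏-cong n numerator≈)
          (∏-shift {λ j → 1# - E j} n (λ j → +-congˡ (-‿cong (E-periodic j))) (b ℕ.* g))))
        where
        -- The exponent that `E-shift` produces for the translation by `b g`. Since `k = 2 b g`, one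
        -- has `Y + k = 2 b g (1 + c g) = a b n`.
        Y = 2 ℕ.* (c ℕ.* g) ℕ.* (b ℕ.* g)
        n∣Y+k : n ∣ Y ℕ.+ k
        n∣Y+k = divides (a ℕ.* b) (≡-R.begin
          Y ℕ.+ k                              ≡-R.≡⟨ ≡.cong (Y ℕ.+_) (≡.trans k≡ (≡.cong (ℕ._* g) h≡)) ⟩
          Y ℕ.+ 2 ℕ.* b ℕ.* g                  ≡-R.≡⟨ lem c g b ⟩
          suc (c ℕ.* g) ℕ.* (2 ℕ.* b ℕ.* g)    ≡-R.≡⟨ ≡.cong (ℕ._* (2 ℕ.* b ℕ.* g)) ah≡ ⟨
          a ℕ.* h ℕ.* (2 ℕ.* b ℕ.* g)          ≡-R.≡⟨ lem′ a h b g ⟩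
          a ℕ.* b ℕ.* (2 ℕ.* h ℕ.* g)          ≡-R.≡⟨ ≡.cong (a ℕ.* b ℕ.*_) (n≡ N) ⟨
          a ℕ.* b ℕ.* n                        ≡-R.∎)
          where
          module ≡-R = ≡.≡-Reasoning
          lem : ∀ c g b → 2 ℕ.* (c ℕ.* g) ℕ.* (b ℕ.* g) ℕ.+ 2 ℕ.* b ℕ.* g ≡ suc (c ℕ.* g) ℕ.* (2 ℕ.* b ℕ.* g)
          lem = solve-∀
          lem′ : ∀ a h b g → a ℕ.* h ℕ.* (2 ℕ.* b ℕ.* g) ≡ a ℕ.* b ℕ.* (2 ℕ.* h ℕ.* g)
          lem′ = solve-∀
        -- `ζ ^ k` is its own inverse, so `Y ≡ - k` gives `ζ ^ Y = ζ ^ k`.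
        ζʸ≈-1 : ζ ^ Y ≈ - 1#
        ζʸ≈-1 = trans (inverse-unique (ζ^-inverse {Y} {k} n∣Y+k) ζᵏζᵏ≈1) ζᵏ≈-1
        numerator≈ : ∀ j → 1# + E j ≈ 1# - E (b ℕ.* g ℕ.+ j)
        numerator≈ j = +-congˡ (begin
          E j                            ≈⟨ E-shift (b ℕ.* g) j ⟩
          E (b ℕ.* g ℕ.+ j) * ζ ^ Y      ≈⟨ *-congˡ ζʸ≈-1 ⟩
          E (b ℕ.* g ℕ.+ j) * - 1#       ≈⟨ -‿distribʳ-* _ 1# ⟨
          - (E (b ℕ.* g ℕ.+ j) * 1#)     ≈⟨ -‿cong (*-identityʳ _) ⟩
          - E (b ℕ.* g ℕ.+ j)            ∎)

      product≈iverson : foldr _*_ 1# (map factor (upTo n)) ≈ ofℕ (iverson2∣ h)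
      product≈iverson with even⊎odd h
      ... | inj₁ (b , h≡) = trans (product-even {b} h≡)
        (sym (trans (reflexive (≡.cong ofℕ (iverson2∣-even (divides b (≡.trans h≡ (ℕ.*-comm 2 b)))))) (+-identityʳ 1#)))
      ... | inj₂ (b , h≡) = trans (product-odd {b} h≡) (sym (reflexive (≡.cong ofℕ (iverson2∣-odd 2∤h))))
        where
        2∤h : ¬ 2 ∣ h
        2∤h (divides q h≡′) = ℕ.even≢odd q b (≡.trans (ℕ.*-comm 2 q) (≡.trans (≡.sym h≡′) h≡))

    quasiSum≈ : quasiSum k ζ ≈ ofℕ (sum (map (λ d → d ℕ.* iverson2∣ d) (unitaryDivisors k)))
    quasiSum≈ = trans (sum-ofℕ _ (iverson2∣ ∘ unitaryPart k) (Q k) (λ π∈ → product≈iverson (∈-Q⁻ π∈)))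
      (reflexive (≡.cong ofℕ (sum-Q k iverson2∣)))

    -- For `k` even, `S` is the increase from `s1* k` to `s1* (2 k)`, that is, from the size of
    -- `Q k` to that of `Q (2 k)`. For `k` odd, every divisor of `k` is odd, so both sides vanish.
    quasiSum-Q : quasiSum k ζ ≈ ofℕ (iverson2∣ k) * (ofℕ (length (Q n)) - ofℕ (length (Q k)))
    quasiSum-Q = trans quasiSum≈ (go (even? k))
      where
      S = sum (map (λ d → d ℕ.* iverson2∣ d) (unitaryDivisors k))

      go : 2 ∣ k ⊎ ¬ 2 ∣ k → ofℕ S ≈ ofℕ (iverson2∣ k) * (ofℕ (length (Q n)) - ofℕ (length (Q k)))
      go (inj₁ 2∣k) = sym (begin
        ofℕ (iverson2∣ k) * (ofℕ (length (Q n)) - ofℕ (length (Q k)))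
          ≡⟨ ≡.cong₂ (λ x y → ofℕ x * (ofℕ y - ofℕ (length (Q k)))) (iverson2∣-even 2∣k) lengths ⟩
        (1# + 0#) * (ofℕ (length (Q k) ℕ.+ S) - ofℕ (length (Q k)))  ≈⟨ *-congʳ (+-identityʳ 1#) ⟩
        1# * (ofℕ (length (Q k) ℕ.+ S) - ofℕ (length (Q k)))         ≈⟨ *-identityˡ _ ⟩
        ofℕ (length (Q k) ℕ.+ S) - ofℕ (length (Q k))   ≈⟨ +-congʳ (ofℕ-+ (length (Q k)) S) ⟩
        ofℕ (length (Q k)) + ofℕ S - ofℕ (length (Q k)) ≈⟨ xyx⁻¹≈y _ _ ⟩
        ofℕ S                                           ∎)
        where
        lengths : length (Q n) ≡ length (Q k) ℕ.+ S
        lengths = ≡.trans (length-Q n) (≡.trans (s1*-double k 2∣k) (≡.cong (ℕ._+ S) (≡.sym (length-Q k))))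
      go (inj₂ 2∤k) = begin
        ofℕ S      ≡⟨ ≡.cong ofℕ S≡0 ⟩
        0#         ≈⟨ zeroˡ _ ⟨
        0# * (ofℕ (length (Q n)) - ofℕ (length (Q k)))
          ≡⟨ ≡.cong (λ x → ofℕ x * (ofℕ (length (Q n)) - ofℕ (length (Q k)))) (iverson2∣-odd 2∤k) ⟨
        ofℕ (iverson2∣ k) * (ofℕ (length (Q n)) - ofℕ (length (Q k))) ∎
        where
        S≡0 : S ≡ 0
        S≡0 = ≡.trans (sum-constant (λ d → d ℕ.* iverson2∣ d) 0 (unitaryDivisors k) λ {d} d∈ →
            let g , k≡ , _ = ∈-unitaryDivisors⁻ {k} d∈
            in ≡.trans (≡.cong (d ℕ.*_) (iverson2∣-odd λ 2∣d → 2∤k (≡.subst (2 ∣_) (≡.sym k≡) (∣m⇒∣m*n g 2∣d)))) (ℕ.*-zeroʳ d))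
          (ℕ.*-zeroʳ (length (unitaryDivisors k)))

-- The field identity and the integer identity together.

open import Level using (Level)
open import Data.Nat using (ℕ; suc; _≤_)
open import Data.List using (length)
open import Data.Integer using (+_; _-_; _*_)
open import Data.Product using (_×_; _,_)
open import Relation.Binary.PropositionalEquality using (_≡_; cong₂)
open Counting using (length-Q)

theorem2 : {c ℓ : Level} (F : CharZeroField c ℓ) (k : ℕ) → 1 ≤ k →
    (ζ : CharZeroField.Carrier F) → CharZeroField.IsPrimitiveRoot F (2 Data.Nat.* k) ζ →
    CharZeroField._≈_ F (CharZeroField.quasiSum F k ζ)
    (CharZeroField._*_ F (CharZeroField.ofℕ F (iverson2∣ k))
    (CharZeroField._-_ F (CharZeroField.ofℕ F (length (Q (2 Data.Nat.* k))))
    (CharZeroField.ofℕ F (length (Q k)))))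
    × (+ iverson2∣ k * (+ length (Q (2 Data.Nat.* k)) - + length (Q k))
    ≡ + iverson2∣ k * (+ s1* (2 Data.Nat.* k) - + s1* k))
theorem2 F (suc m) _ ζ ζ-primitive =
  FieldProducts.quasiSum-Q F ζ-primitive ,
  cong₂ (λ x y → + iverson2∣ (suc m) * (+ x - + y)) (length-Q (2 Data.Nat.* suc m)) (length-Q (suc m))
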